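{- Let $G=(V,E)$ be a graph and $f\colon V\to\{0,1,2\}$ a function. On input $(G,f)$, the algorithm ExtRD Solver (given in the context) returns "yes" if and only if $(G,f)$ is a yes-instance of Extension Roman Domination. In this case, the function $\widetilde f$ computed by the algorithm is a minimal Roman dominating function of $G$.
   Context: Graphs are finite, undirected and simple; $N_G(v)$ and $N_G[v]=N_G(v)\cup\{v\}$ are open and closed neighborhoods, and $N_G[U]=\bigcup_{u\in U}N_G[u]$. For $f\colon V\to\{0,1,2\}$ let $V_i(f)=\{v\in V\mid f(v)=i\}$. $f$ is a Roman dominating function (rdf) if every $v$ with $f(v)=0$ has a neighbor $u$ with $f(u)=2$. $f\le g$ means $f(v)\le g(v)$ for all $v\in V$ (with $0<1<2$); an rdf $f$ is minimal if there is no rdf $g\ne f$ with $g\le f$. Extension Roman Domination: given a graph $G=(V,E)$ and $f\in\{0,1,2\}^V$, is there a minimal rdf $\widetilde f\in\{0,1,2\}^V$ of $G$ with $f\le\widetilde f$? Algorithm ExtRD Solver, on input $(G,f)$: (i) Set $\widetilde f:=f$, $M_2:=V_2(f)$, $M:=M_2$. (ii) While $M\ne\emptyset$: choose $v\in M$; for each $u\in N_G(v)$ with $\widetilde f(u)=1$, set $\widetilde f(u):=2$ and add $u$ to $M$ and to $M_2$; then delete $v$ from $M$. (iii) For each $v\in M_2$: if $N_G(v)\subseteq N_G[M_2\setminus\{v\}]$, return "no" (and stop). (iv) For each $v\in V\setminus N_G[M_2]$, set $\widetilde f(v):=1$. (v) Return "yes". -}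

module Defs where

open import Data.Bool.Base using (true; false; if_then_else_)
open import Data.Fin.Base using (Fin; _≤_)
open import Data.Fin.Patterns using (0F; 1F; 2F)
open import Data.Fin.Properties using (any?; _≟_)
open import Data.Fin.Subset
  using (Subset; _∈_; _∉_; _⊆_; _∩_; _∪_; _-_; ∁; ⁅_⁆; ∣_∣; Nonempty)
open import Data.Fin.Subset.Properties
open import Data.Nat.Base as ℕ using (ℕ; _+_)
import Data.Nat.Properties as ℕₚ
open import Data.Nat.Induction using (<-wellFounded)
open import Data.Product.Base using (∃-syntax; _×_; _,_)
open import Data.Vec.Base using (tabulate; []; _∷_; here; there)
open import Data.Vec.Properties using (lookup∘tabulate; []=⇒lookup; lookup⇒[]=)
open import Function.Base using (_∘_)
open import Induction.WellFounded using (Acc; acc)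
open import Level using (Level; 0ℓ)
open import Relation.Binary.Core using (Rel)
import Relation.Binary.Definitions as B
open import Relation.Binary.PropositionalEquality
  using (_≡_; _≗_; sym; trans)
open import Relation.Nullary using (yes; no; does; ¬_; contradiction; _×-dec_)
open import Relation.Nullary.Decidable using (dec-true)
open import Relation.Unary using (Pred; Decidable)

private variable
  n : ℕ
  ℓ : Level

record Graph (n : ℕ) : Set₁ where
  field
    Adj         : Rel (Fin n) 0ℓ
    adj?        : B.Decidable Adj
    symmetric   : B.Symmetric Adj
    irreflexive : B.Irreflexive _≡_ Adj

open Graph public

Labelling : ℕ → Set
Labelling n = Fin n → Fin 3

infix 4 _≤ₗ_
_≤ₗ_ : Labelling n → Labelling n → Set
f ≤ₗ g = ∀ v → f v ≤ g v

IsRdf : Graph n → Labelling n → Set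
IsRdf G f = ∀ v → f v ≡ 0F → ∃[ u ] Adj G v u × f u ≡ 2F

-- Labellings are functions, so "g ≠ f" is the negation of pointwise equality.
IsMinimalRdf : Graph n → Labelling n → Set
IsMinimalRdf G f =
  IsRdf G f × ¬ (∃[ g ] IsRdf G g × ¬ (g ≗ f) × g ≤ₗ f)

ExtensionRomanDomination : Graph n → Labelling n → Set
ExtensionRomanDomination G f = ∃[ f̃ ] IsMinimalRdf G f̃ × f ≤ₗ f̃

⟪_⟫ : {P : Pred (Fin n) ℓ} → Decidable P → Subset n
⟪ P? ⟫ = tabulate (does ∘ P?)

V : Fin 3 → Labelling n → Subset n
V i f = ⟪ (λ v → f v ≟ i) ⟫

N : Graph n → Fin n → Subset n
N G v = ⟪ adj? G v ⟫

N[_] : Graph n → Fin n → Subset n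
N[ G ] v = N G v ∪ ⁅ v ⁆

N[_]⋃ : Graph n → Subset n → Subset n
N[ G ]⋃ U = ⟪ (λ w → any? λ u → u ∈? U ×-dec w ∈? N[ G ] u) ⟫

infix 6 _[_≔_]
_[_≔_] : Labelling n → Subset n → Fin 3 → Labelling n
(f [ S ≔ i ]) u = if does (u ∈? S) then i else f u

record State (n : ℕ) : Set where
  constructor ⟨_,_,_⟩
  field
    f̃  : Labelling n
    M₂ : Subset n
    M  : Subset n

open State public

initial : Labelling n → State n
initial f = ⟨ f , V 2F f , V 2F f ⟩

-- One pass through the body of the while loop.  The inner "for each u" only
-- reads f̃ at u itself, so all neighbours labelled 1 may be treated at once.
process : Graph n → Fin n → State n → State n
process G v ⟨ f̃ , M₂ , M ⟩ = ⟨ f̃ [ U ≔ 2F ] , M₂ ∪ U , (M ∪ U) - v ⟩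
  where U = N G v ∩ V 1F f̃

-- A way of resolving every "choose v ∈ M".  Since `measure` below strictly
-- decreases, no state recurs during a run, so strategies that look only at
-- the current state realise all possible runs.
Strategy : ℕ → Set
Strategy n = (s : State n) → Nonempty (M s) → ∃[ v ] v ∈ M s

measure : State n → ℕ
measure s = ∣ M s ∣ + ∣ V 1F (f̃ s) ∣

private
  ∈⟪⟫⁻ : {P : Pred (Fin n) ℓ} (P? : Decidable P) {x : Fin n} → x ∈ ⟪ P? ⟫ → P x
  ∈⟪⟫⁻ P? {x} x∈ with P? x | trans (sym (lookup∘tabulate (does ∘ P?) x)) ([]=⇒lookup x∈)
  ... | yes p | _  = p
  ... | no _  | ()

  ∈⟪⟫⁺ : {P : Pred (Fin n) ℓ} (P? : Decidable P) {x : Fin n} → P x → x ∈ ⟪ P? ⟫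
  ∈⟪⟫⁺ P? {x} p = lookup⇒[]= x _ (trans (lookup∘tabulate (does ∘ P?) x) (dec-true (P? x) p))

  ∣p∪q∣+∣r∣≤∣p∣+∣s∣ : (p q r s : Subset n) → q ⊆ s → r ⊆ s → (∀ {x} → x ∈ q → x ∉ r) →
                     ∣ p ∪ q ∣ + ∣ r ∣ ℕ.≤ ∣ p ∣ + ∣ s ∣
  ∣p∪q∣+∣r∣≤∣p∣+∣s∣ [] [] [] [] _ _ _ = ℕ.z≤n
  ∣p∪q∣+∣r∣≤∣p∣+∣s∣ (a ∷ p) (b ∷ q) (c ∷ r) (d ∷ s) h k l
    with ∣p∪q∣+∣r∣≤∣p∣+∣s∣ p q r s (drop-there ∘ h ∘ there) (drop-there ∘ k ∘ there) (λ x y → l (there x) (there y))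
  ∣p∪q∣+∣r∣≤∣p∣+∣s∣ (a ∷ p) (true ∷ q) (true ∷ r) (d ∷ s) h k l | ih = contradiction here (l here)
  ∣p∪q∣+∣r∣≤∣p∣+∣s∣ (a ∷ p) (true ∷ q) (false ∷ r) (false ∷ s) h k l | ih = contradiction (h here) λ ()
  ∣p∪q∣+∣r∣≤∣p∣+∣s∣ (a ∷ p) (false ∷ q) (true ∷ r) (false ∷ s) h k l | ih = contradiction (k here) λ ()
  ∣p∪q∣+∣r∣≤∣p∣+∣s∣ (false ∷ p) (true ∷ q) (false ∷ r) (true ∷ s) h k l | ih
    rewrite ℕₚ.+-suc ∣ p ∣ ∣ s ∣ = ℕ.s≤s ih
  ∣p∪q∣+∣r∣≤∣p∣+∣s∣ (true ∷ p) (true ∷ q) (false ∷ r) (true ∷ s) h k l | ih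
    rewrite ℕₚ.+-suc ∣ p ∣ ∣ s ∣ = ℕ.s≤s (ℕₚ.m≤n⇒m≤1+n ih)
  ∣p∪q∣+∣r∣≤∣p∣+∣s∣ (false ∷ p) (false ∷ q) (true ∷ r) (true ∷ s) h k l | ih
    rewrite ℕₚ.+-suc ∣ p ∣ ∣ s ∣ | ℕₚ.+-suc ∣ p ∪ q ∣ ∣ r ∣ = ℕ.s≤s ih
  ∣p∪q∣+∣r∣≤∣p∣+∣s∣ (true ∷ p) (false ∷ q) (true ∷ r) (true ∷ s) h k l | ih
    rewrite ℕₚ.+-suc ∣ p ∣ ∣ s ∣ | ℕₚ.+-suc ∣ p ∪ q ∣ ∣ r ∣ = ℕ.s≤s (ℕ.s≤s ih)
  ∣p∪q∣+∣r∣≤∣p∣+∣s∣ (false ∷ p) (false ∷ q) (false ∷ r) (false ∷ s) h k l | ih = ih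
  ∣p∪q∣+∣r∣≤∣p∣+∣s∣ (true ∷ p) (false ∷ q) (false ∷ r) (false ∷ s) h k l | ih = ℕ.s≤s ih
  ∣p∪q∣+∣r∣≤∣p∣+∣s∣ (false ∷ p) (false ∷ q) (false ∷ r) (true ∷ s) h k l | ih
    rewrite ℕₚ.+-suc ∣ p ∣ ∣ s ∣ = ℕₚ.m≤n⇒m≤1+n ih
  ∣p∪q∣+∣r∣≤∣p∣+∣s∣ (true ∷ p) (false ∷ q) (false ∷ r) (true ∷ s) h k l | ih
    rewrite ℕₚ.+-suc ∣ p ∣ ∣ s ∣ = ℕ.s≤s (ℕₚ.m≤n⇒m≤1+n ih)

process-decreases : (G : Graph n) (s : State n) {v : Fin n} → v ∈ M s →
                    measure (process G v s) ℕ.< measure s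
process-decreases G s@(⟨ f̃ , M₂ , M ⟩) {v} v∈M = ℕₚ.<-≤-trans
  (ℕₚ.+-monoˡ-< ∣ V₁′ ∣ (x∈p⇒∣p-x∣<∣p∣ (p⊆p∪q U v∈M)))
  (∣p∪q∣+∣r∣≤∣p∣+∣s∣ M U V₁′ (V 1F f̃) (p∩q⊆q (N G v) (V 1F f̃)) V₁′⊆V₁ disjoint)
  where
  U V₁′ : Subset _
  U   = N G v ∩ V 1F f̃
  V₁′ = V 1F (f̃ [ U ≔ 2F ])

  V₁′⊆V₁ : V₁′ ⊆ V 1F f̃
  V₁′⊆V₁ {x} x∈ with x ∈? U | ∈⟪⟫⁻ (λ u → (f̃ [ U ≔ 2F ]) u ≟ 1F) x∈
  ... | no _ | eq = ∈⟪⟫⁺ (λ u → f̃ u ≟ 1F) eq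

  disjoint : ∀ {x} → x ∈ U → x ∉ V₁′
  disjoint {x} x∈U x∈ with x ∈? U | ∈⟪⟫⁻ (λ u → (f̃ [ U ≔ 2F ]) u ≟ 1F) x∈
  ... | no x∉U | _ = x∉U x∈U

while : Graph n → Strategy n → (s : State n) → Acc ℕ._<_ (measure s) → State n
while G choose s (acc rec) with nonempty? (M s)
... | no  _   = s
... | yes M≢∅ =
  let (v , v∈M) = choose s M≢∅
  in  while G choose (process G v s) (rec (process-decreases G s v∈M))

data Answer : Set where
  YES NO : Answer

record Output (n : ℕ) : Set where
  field
    answer   : Answer
    computed : Labelling n

open Output public

finish : Graph n → State n → Output n
finish G ⟨ f̃ , M₂ , _ ⟩ with any? (λ v → v ∈? M₂ ×-dec N G v ⊆? N[ G ]⋃ (M₂ - v))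
... | yes _ = record { answer = NO  ; computed = f̃ }
... | no  _ = record { answer = YES ; computed = f̃ [ ∁ (N[ G ]⋃ M₂) ≔ 1F ] }

extRDSolver : Strategy n → Graph n → Labelling n → Output n
extRDSolver choose G f =
  finish G (while G choose (initial f) (<-wellFounded (measure (initial f))))

{-# OPTIONS --safe #-}

-- Raising to 2 every neighbour labelled 1 of a vertex labelled 2 is forced,
-- since in a minimal rdf no vertex labelled 1 has a neighbour labelled 2.
-- A vertex v of a minimal rdf labelled 2 must have a neighbour dominated by no
-- other vertex labelled 2, since otherwise v could be relabelled 1; as M₂ only
-- grows into the set of vertices labelled 2 of any solution, the test in (iii)
-- rejects only no-instances.  Conversely, if the test passes, the vertices of
-- N[M₂] ∖ M₂ are labelled 0 and the private neighbours found by the test forbid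
-- lowering any label 2, while a label 1 outside N[M₂] has no neighbour
-- labelled 2 and cannot be lowered either.
module Submission where

open import Defs
open import Data.Bool.Base using (true)
open import Data.Empty using (⊥-elim)
open import Data.Fin.Base as Fin using (Fin)
open import Data.Fin.Patterns using (0F; 1F; 2F)
open import Data.Fin.Properties using (any?; _≟_; ≤-refl; ≤-reflexive; ≤-trans; ≤-antisym; <⇒≢)
open import Data.Fin.Subset using (Subset; _∈_; _∉_; _⊆_; _∩_; _∪_; _─_; _-_; ∁; ⁅_⁆; Empty)
open import Data.Fin.Subset.Properties
  using (_∈?_; _⊆?_; nonempty?; x∈⁅x⁆; x∈⁅y⁆⇒x≡y; x∈p∪q⁺; x∈p∪q⁻; x∈p∩q⁺; x∈p∩q⁻;
         x∈p∧x≢y⇒x∈p-y; x∈∁p⇒x∉p; x∉∁p⇒x∈p; p─q⊆p)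
open import Data.Nat.Base as ℕ using (ℕ; z≤n; s≤s)
import Data.Nat.Properties as ℕₚ
open import Data.Nat.Induction using (<-wellFounded)
open import Data.Product.Base using (∃-syntax; _×_; _,_; proj₁; proj₂)
open import Data.Sum.Base using (_⊎_; inj₁; inj₂; [_,_])
open import Data.Vec.Base using (_∷_; here; there)
open import Data.Vec.Properties using (lookup∘tabulate; []=⇒lookup; lookup⇒[]=)
open import Function.Base using (_∘_; id)
open import Function.Bundles using (_⇔_; mk⇔)
open import Induction.WellFounded using (Acc; acc)
open import Level using (Level; 0ℓ)
open import Relation.Binary.Core using (Rel)
open import Relation.Binary.PropositionalEquality
  using (_≡_; _≢_; refl; sym; trans; subst)
open import Relation.Nullary using (yes; no; does; ¬_; contradiction; _×-dec_)
open import Relation.Nullary.Decidable using (dec-true; dec-false)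
open import Relation.Unary using (Pred; Decidable)

private variable
  n : ℕ
  ℓ : Level

-- Membership in the computed sets, and updated labellings.

∈⟪⟫⁻ : {P : Pred (Fin n) ℓ} (P? : Decidable P) {x : Fin n} → x ∈ ⟪ P? ⟫ → P x
∈⟪⟫⁻ P? {x} x∈ with P? x | trans (sym (lookup∘tabulate (does ∘ P?) x)) ([]=⇒lookup x∈)
... | yes p | _ = p

∈⟪⟫⁺ : {P : Pred (Fin n) ℓ} (P? : Decidable P) {x : Fin n} → P x → x ∈ ⟪ P? ⟫
∈⟪⟫⁺ P? {x} p = lookup⇒[]= x _ (trans (lookup∘tabulate (does ∘ P?) x) (dec-true (P? x) p))

∈V⁻ : (f : Labelling n) {i : Fin 3} {v : Fin n} → v ∈ V i f → f v ≡ i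
∈V⁻ f = ∈⟪⟫⁻ (λ v → f v ≟ _)

∈V⁺ : (f : Labelling n) {i : Fin 3} {v : Fin n} → f v ≡ i → v ∈ V i f
∈V⁺ f = ∈⟪⟫⁺ (λ v → f v ≟ _)

∈N⁻ : (G : Graph n) {v u : Fin n} → u ∈ N G v → Adj G v u
∈N⁻ G {v} = ∈⟪⟫⁻ (adj? G v)

∈N⁺ : (G : Graph n) {v u : Fin n} → Adj G v u → u ∈ N G v
∈N⁺ G {v} = ∈⟪⟫⁺ (adj? G v)

∈N[]⋃⁻ : (G : Graph n) (U : Subset n) {w : Fin n} → w ∈ N[ G ]⋃ U →
         w ∈ U ⊎ (∃[ u ] u ∈ U × Adj G w u)
∈N[]⋃⁻ G U {w} w∈ with ∈⟪⟫⁻ (λ w → any? λ u → u ∈? U ×-dec w ∈? N[ G ] u) w∈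
... | u , u∈U , w∈N[u] with x∈p∪q⁻ (N G u) ⁅ u ⁆ w∈N[u]
...   | inj₁ w∈N = inj₂ (u , u∈U , symmetric G (∈N⁻ G w∈N))
...   | inj₂ w∈⁅u⁆ = inj₁ (subst (_∈ U) (sym (x∈⁅y⁆⇒x≡y u w∈⁅u⁆)) u∈U)

∈N[]⋃-self : (G : Graph n) (U : Subset n) {w : Fin n} → w ∈ U → w ∈ N[ G ]⋃ U
∈N[]⋃-self G U w∈U = ∈⟪⟫⁺ (λ w → any? λ u → u ∈? U ×-dec w ∈? N[ G ] u)
  (_ , w∈U , x∈p∪q⁺ (inj₂ (x∈⁅x⁆ _)))

∈N[]⋃-adj : (G : Graph n) (U : Subset n) {w u : Fin n} → u ∈ U → Adj G w u → w ∈ N[ G ]⋃ U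
∈N[]⋃-adj G U u∈U w~u = ∈⟪⟫⁺ (λ w → any? λ u → u ∈? U ×-dec w ∈? N[ G ] u)
  (_ , u∈U , x∈p∪q⁺ (inj₁ (∈N⁺ G (symmetric G w~u))))

≔-∈ : (f : Labelling n) (S : Subset n) {i : Fin 3} {u : Fin n} → u ∈ S → (f [ S ≔ i ]) u ≡ i
≔-∈ f S {u = u} u∈S rewrite dec-true (u ∈? S) u∈S = refl

≔-∉ : (f : Labelling n) (S : Subset n) {i : Fin 3} {u : Fin n} → u ∉ S → (f [ S ≔ i ]) u ≡ f u
≔-∉ f S {u = u} u∉S rewrite dec-false (u ∈? S) u∉S = refl

≔-≢ : (f : Labelling n) {v : Fin n} {i : Fin 3} {u : Fin n} → u ≢ v → (f [ ⁅ v ⁆ ≔ i ]) u ≡ f u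
≔-≢ f u≢v = ≔-∉ f ⁅ _ ⁆ (u≢v ∘ x∈⁅y⁆⇒x≡y _)

x∈p─q⇒x∉q : (p q : Subset n) {x : Fin n} → x ∈ p ─ q → x ∉ q
x∈p─q⇒x∉q (_ ∷ p) (_ ∷ q) (there x∈) (there x∈q) = x∈p─q⇒x∉q p q x∈ x∈q
x∈p─q⇒x∉q (_ ∷ p) (true ∷ q) () here

x∈p-y⁻ : (p : Subset n) {x y : Fin n} → x ∈ p - y → x ∈ p × x ≢ y
x∈p-y⁻ p {y = y} x∈ =
  p─q⊆p p ⁅ y ⁆ x∈ , λ { refl → x∈p─q⇒x∉q p ⁅ y ⁆ x∈ (x∈⁅x⁆ y) }

-- Homogeneous, so that the numerals 0F, 1F, 2F are elements of Fin 3.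
infix 4 _≤_ _<_
_≤_ _<_ : Rel (Fin 3) 0ℓ
_≤_ = Fin._≤_
_<_ = Fin._<_

≤2 : (i : Fin 3) → i ≤ 2F
≤2 0F = z≤n
≤2 1F = s≤s z≤n
≤2 2F = s≤s (s≤s z≤n)

≢2⇒≤1 : {i : Fin 3} → i ≢ 2F → i ≤ 1F
≢2⇒≤1 {0F} _   = z≤n
≢2⇒≤1 {1F} _   = s≤s z≤n
≢2⇒≤1 {2F} i≢2 = contradiction refl i≢2

2≤⇒≡2 : {i : Fin 3} → 2F ≤ i → i ≡ 2F
2≤⇒≡2 {i} = ≤-antisym (≤2 i)

≤0⇒≡0 : {i : Fin 3} → i ≤ 0F → i ≡ 0F
≤0⇒≡0 i≤0 = ≤-antisym i≤0 z≤n

-- Necessary conditions on a minimal rdf.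

module _ (G : Graph n) {h : Labelling n} (minimal : IsMinimalRdf G h) where

  -- Below, minimality is applied only through changes at a single vertex: from 1 to 0, then from 2
  -- to 1.
  relabel-lower-¬rdf : {v : Fin n} {i : Fin 3} → i < h v → ¬ IsRdf G (h [ ⁅ v ⁆ ≔ i ])
  relabel-lower-¬rdf {v} {i} i<hv rdf = proj₂ minimal
    (h [ ⁅ v ⁆ ≔ i ] , rdf ,
     (λ eq → <⇒≢ i<hv (trans (sym (≔-∈ h ⁅ v ⁆ (x∈⁅x⁆ v))) (eq v))) , lower)
    where
    lower : h [ ⁅ v ⁆ ≔ i ] ≤ₗ h
    lower u with u ≟ v
    ... | yes refl rewrite ≔-∈ h ⁅ v ⁆ {i} (x∈⁅x⁆ v) = ℕₚ.<⇒≤ i<hv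
    ... | no u≢v = ≤-reflexive (≔-≢ h u≢v)

  -- Otherwise lowering `u` to 0 leaves an rdf: `v` dominates `u`, and as `u` had label 1, no vertex
  -- loses a neighbour labelled 2.
  minimal⇒2-adj⇒≢1 : {v u : Fin n} → Adj G v u → h v ≡ 2F → h u ≢ 1F
  minimal⇒2-adj⇒≢1 {v} {u} v~u hv≡2 hu≡1 =
    relabel-lower-¬rdf (subst (0F <_) (sym hu≡1) (s≤s z≤n)) rdf
    where
    keeps-2 : ∀ {w} → h w ≡ 2F → (h [ ⁅ u ⁆ ≔ 0F ]) w ≡ 2F
    keeps-2 hw≡2 = trans (≔-≢ h λ { refl → contradiction (trans (sym hw≡2) hu≡1) λ () }) hw≡2

    rdf : IsRdf G (h [ ⁅ u ⁆ ≔ 0F ])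
    rdf x hx≡0 with x ≟ u
    ... | yes refl = v , symmetric G v~u , keeps-2 hv≡2
    ... | no x≢u with proj₁ minimal x (trans (sym (≔-≢ h x≢u)) hx≡0)
    ...   | w , x~w , hw≡2 = w , x~w , keeps-2 hw≡2

  -- Otherwise `v` could drop to 1. A vertex labelled 0 that relied on `v` is covered by `S - v`;
  -- having label 0 it is outside `S`, so it has a neighbour in `S - v`, which keeps its label 2.
  -- The set `S` is arbitrary because `M₂` may miss vertices that `h` labels 2.
  minimal⇒private-neighbour : {S : Subset n} → (∀ {w} → w ∈ S → h w ≡ 2F) →
                              ∀ {v} → v ∈ S → ¬ N G v ⊆ N[ G ]⋃ (S - v)
  minimal⇒private-neighbour {S} S⊆V₂ {v} v∈S covered =
    relabel-lower-¬rdf {i = 1F} (subst (1F <_) (sym (S⊆V₂ v∈S)) (s≤s (s≤s z≤n))) rdf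
    where
    rdf : IsRdf G (h [ ⁅ v ⁆ ≔ 1F ])
    rdf x hx≡0 with x ≟ v
    ... | yes refl = contradiction (trans (sym hx≡0) (≔-∈ h ⁅ v ⁆ (x∈⁅x⁆ v))) λ ()
    ... | no x≢v with proj₁ minimal x (trans (sym (≔-≢ h x≢v)) hx≡0)
    ...   | w , x~w , hw≡2 with w ≟ v
    ...     | no w≢v = w , x~w , trans (≔-≢ h w≢v) hw≡2
    ...     | yes refl with ∈N[]⋃⁻ G (S - v) (covered (∈N⁺ G (symmetric G x~w)))
    ...       | inj₁ x∈S-v = contradiction
                  (trans (sym (S⊆V₂ (proj₁ (x∈p-y⁻ S x∈S-v)))) (trans (sym (≔-≢ h x≢v)) hx≡0)) λ ()
    ...       | inj₂ (u , u∈S-v , x~u) with x∈p-y⁻ S u∈S-v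
    ...         | u∈S , u≢v = u , x~u , trans (≔-≢ h u≢v) (S⊆V₂ u∈S)

-- The while loop and its invariant.

while-induction : (G : Graph n) (choose : Strategy n) (P : State n → Set) →
                  (∀ s {v} → v ∈ M s → P s → P (process G v s)) →
                  ∀ s (a : Acc ℕ._<_ (measure s)) → P s →
                  P (while G choose s a) × Empty (M (while G choose s a))
while-induction G choose P step s (acc rec) Ps with nonempty? (M s)
... | no M≡∅ = Ps , M≡∅
... | yes M≢∅ with choose s M≢∅
...   | v , v∈M = while-induction G choose P step _ (rec (process-decreases G s v∈M)) (step s v∈M Ps)

-- Once `M` is empty, `settled` means that no vertex of `M₂` has a neighbour labelled 1. The answer
-- "no" rests on `below`: with `M₂⇒2` it forces label 2 on all of `M₂` in every solution `h`.
record Invariant (G : Graph n) (f : Labelling n) (s : State n) : Set where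
  field
    extends  : f ≤ₗ f̃ s
    M₂⇒2     : ∀ {v} → v ∈ M₂ s → f̃ s v ≡ 2F
    2⇒M₂     : ∀ {v} → f̃ s v ≡ 2F → v ∈ M₂ s
    M⊆M₂     : M s ⊆ M₂ s
    settled  : ∀ {v u} → v ∈ M₂ s → v ∉ M s → Adj G v u → f̃ s u ≢ 1F
    below    : ∀ {h} → IsMinimalRdf G h → f ≤ₗ h → f̃ s ≤ₗ h

open Invariant

initial-invariant : (G : Graph n) (f : Labelling n) → Invariant G f (initial f)
initial-invariant G f = record
  { extends = λ _ → ≤-refl
  ; M₂⇒2    = ∈V⁻ f
  ; 2⇒M₂    = ∈V⁺ f
  ; M⊆M₂    = id
  ; settled = λ v∈M₂ v∉M → contradiction v∈M₂ v∉M
  ; below   = λ _ f≤h → f≤h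
  }

process-invariant : (G : Graph n) (f : Labelling n) (s : State n) {v : Fin n} → v ∈ M s →
                    Invariant G f s → Invariant G f (process G v s)
process-invariant {n} G f ⟨ f̃₀ , M₂₀ , M₀ ⟩ {v} v∈M inv = record
  { extends = extends′
  ; M₂⇒2    = M₂⇒2′
  ; 2⇒M₂    = 2⇒M₂′
  ; M⊆M₂    = x∈p∪q⁺ ∘ [ inj₁ ∘ M⊆M₂ inv , inj₂ ] ∘ x∈p∪q⁻ M₀ U ∘ proj₁ ∘ x∈p-y⁻ (M₀ ∪ U)
  ; settled = settled′
  ; below   = below′
  }
  where
  U : Subset n
  U = N G v ∩ V 1F f̃₀

  g : Labelling n
  g = f̃₀ [ U ≔ 2F ]

  extends′ : f ≤ₗ g
  extends′ u with u ∈? U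
  ... | yes _ = ≤2 (f u)
  ... | no  _ = extends inv u

  M₂⇒2′ : ∀ {w} → w ∈ M₂₀ ∪ U → g w ≡ 2F
  M₂⇒2′ {w} w∈ with w ∈? U | x∈p∪q⁻ M₂₀ U w∈
  ... | yes _  | _ = refl
  ... | no w∉U | inj₁ w∈M₂ = M₂⇒2 inv w∈M₂
  ... | no w∉U | inj₂ w∈U  = contradiction w∈U w∉U

  2⇒M₂′ : ∀ {w} → g w ≡ 2F → w ∈ M₂₀ ∪ U
  2⇒M₂′ {w} gw≡2 with w ∈? U
  ... | yes w∈U = x∈p∪q⁺ (inj₂ w∈U)
  ... | no  _   = x∈p∪q⁺ (inj₁ (2⇒M₂ inv gw≡2))

  -- No label 1 is created. If `w` is `v`, its neighbours labelled 1 were all in `U` and are now 2;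
  -- any other `w` outside the new `M` was already in `M₂` and settled.
  settled′ : ∀ {w u} → w ∈ M₂₀ ∪ U → w ∉ (M₀ ∪ U) - v → Adj G w u → g u ≢ 1F
  settled′ {w} {u} w∈ w∉ w~u gu≡1 with u ∈? U
  ... | no u∉U with w ≟ v
  ...   | yes refl = u∉U (x∈p∩q⁺ (∈N⁺ G w~u , ∈V⁺ f̃₀ gu≡1))
  ...   | no w≢v with x∈p∪q⁻ M₂₀ U w∈
  ...     | inj₁ w∈M₂ = settled inv w∈M₂ (λ w∈M → w∉ (x∈p∧x≢y⇒x∈p-y (x∈p∪q⁺ (inj₁ w∈M)) w≢v)) w~u gu≡1
  ...     | inj₂ w∈U  = w∉ (x∈p∧x≢y⇒x∈p-y (x∈p∪q⁺ (inj₂ w∈U)) w≢v)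

  -- On `U` the old label 1 gives `h u` at least 1. As `h v` is 2, minimality of `h` excludes 1, so
  -- raising `u` to 2 stays below `h`.
  below′ : ∀ {h} → IsMinimalRdf G h → f ≤ₗ h → g ≤ₗ h
  below′ {h} minimal f≤h u with u ∈? U | below inv minimal f≤h
  ... | no  _   | f̃≤h = f̃≤h u
  ... | yes u∈U | f̃≤h with x∈p∩q⁻ (N G v) (V 1F f̃₀) u∈U
  ...   | u∈N , u∈V₁ = raised (subst (_≤ h u) (∈V⁻ f̃₀ u∈V₁) (f̃≤h u))
                              (minimal⇒2-adj⇒≢1 G minimal (∈N⁻ G u∈N) hv≡2)
    where
    hv≡2 : h v ≡ 2F
    hv≡2 = 2≤⇒≡2 (subst (_≤ h v) (M₂⇒2 inv (M⊆M₂ inv v∈M)) (f̃≤h v))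

    raised : {i : Fin 3} → 1F ≤ i → i ≢ 1F → 2F ≤ i
    raised {1F} _ i≢1 = contradiction refl i≢1
    raised {2F} _ _   = ≤2 2F

-- The labelling after step (iv) and the final answer.

module _ (G : Graph n) (f : Labelling n) (s : State n)
         (inv : Invariant G f s) (M≡∅ : Empty (M s)) where

  private
    D : Subset n
    D = N[ G ]⋃ (M₂ s)

    result : Labelling n
    result = f̃ s [ ∁ D ≔ 1F ]

    result-∉D : ∀ {v} → v ∉ D → result v ≡ 1F
    result-∉D {v} v∉D with v ∈? ∁ D
    ... | yes _ = refl
    ... | no v∉∁D = contradiction (x∉∁p⇒x∈p v∉∁D) v∉D

    result-∈D : ∀ {v} → v ∈ D → result v ≡ f̃ s v
    result-∈D v∈D = ≔-∉ (f̃ s) (∁ D) (λ v∈∁D → x∈∁p⇒x∉p v∈∁D v∈D)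

    M₂⇒result≡2 : ∀ {v} → v ∈ M₂ s → result v ≡ 2F
    M₂⇒result≡2 v∈M₂ = trans (result-∈D (∈N[]⋃-self G (M₂ s) v∈M₂)) (M₂⇒2 inv v∈M₂)

    result≡2⇒M₂ : ∀ {v} → result v ≡ 2F → v ∈ M₂ s
    result≡2⇒M₂ {v} eq with v ∈? D
    ... | yes v∈D = 2⇒M₂ inv (trans (sym (result-∈D v∈D)) eq)
    ... | no v∉D = contradiction (trans (sym (result-∉D v∉D)) eq) λ ()

    M₂-adj⇒result≢1 : ∀ {v u} → u ∈ M₂ s → Adj G v u → result v ≢ 1F
    M₂-adj⇒result≢1 u∈M₂ v~u eq = settled inv u∈M₂ (λ u∈M → M≡∅ (_ , u∈M)) (symmetric G v~u)
      (trans (sym (result-∈D (∈N[]⋃-adj G (M₂ s) u∈M₂ v~u))) eq)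

  result-extends : f ≤ₗ result
  result-extends v with v ∈? D
  ... | yes v∈D = ≤-trans (extends inv v) (≤-reflexive (sym (result-∈D v∈D)))
  -- Overwriting with 1 cannot fall below `f`: label 2 occurs only on `M₂`, which lies inside `D`.
  ... | no v∉D = ≤-trans (extends inv v) (≤-trans
    (≢2⇒≤1 (v∉D ∘ ∈N[]⋃-self G (M₂ s) ∘ 2⇒M₂ inv)) (≤-reflexive (sym (result-∉D v∉D))))

  -- Label 0 survives only in `D` outside `M₂`, hence next to a vertex of `M₂`.
  result-rdf : IsRdf G result
  result-rdf v rv≡0 with v ∈? D
  ... | no v∉D = contradiction (trans (sym (result-∉D v∉D)) rv≡0) λ ()
  ... | yes v∈D with ∈N[]⋃⁻ G (M₂ s) v∈D
  ...   | inj₁ v∈M₂ = contradiction (trans (sym (M₂⇒result≡2 v∈M₂)) rv≡0) λ ()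
  ...   | inj₂ (u , u∈M₂ , v~u) = u , v~u , M₂⇒result≡2 u∈M₂

  result-minimal : (∀ {v} → v ∈ M₂ s → ¬ N G v ⊆ N[ G ]⋃ (M₂ s - v)) → IsMinimalRdf G result
  result-minimal private-neighbour = result-rdf ,
    λ (g , g-rdf , g≢r , g≤r) → g≢r λ v → ≤-antisym (g≤r v) (r≤g g-rdf g≤r v)
    where
    module _ {g : Labelling n} (g-rdf : IsRdf G g) (g≤r : g ≤ₗ result) where

      -- Every vertex that dominates in `g` is thus one of `M₂`, which ties `g` to the test in
      -- (iii).
      g≡2⇒M₂ : ∀ {v} → g v ≡ 2F → v ∈ M₂ s
      g≡2⇒M₂ {v} gv≡2 = result≡2⇒M₂ (2≤⇒≡2 (subst (_≤ result v) gv≡2 (g≤r v)))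

      1-kept : ∀ {v} → result v ≡ 1F → g v ≢ 0F
      1-kept {v} rv≡1 gv≡0 with g-rdf v gv≡0
      ... | u , v~u , gu≡2 = M₂-adj⇒result≢1 (g≡2⇒M₂ gu≡2) v~u rv≡1

      -- A neighbour `u` of `v` cannot have label 1. With label 2 it lies in `M₂ - v` itself. With
      -- label 0 it is also 0 in `g`, and its dominator there lies in `M₂` and differs from `v`.
      lowered⇒covered : ∀ {v} → v ∈ M₂ s → g v ≢ 2F → N G v ⊆ N[ G ]⋃ (M₂ s - v)
      lowered⇒covered {v} v∈M₂ gv≢2 {u} u∈N with result u in ru≡
      ... | 1F = contradiction ru≡ (M₂-adj⇒result≢1 v∈M₂ (symmetric G (∈N⁻ G u∈N)))
      ... | 2F = ∈N[]⋃-self G (M₂ s - v)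
        (x∈p∧x≢y⇒x∈p-y (result≡2⇒M₂ ru≡) λ u≡v → irreflexive G (sym u≡v) (∈N⁻ G u∈N))
      ... | 0F with g-rdf u (≤0⇒≡0 (subst (g u ≤_) ru≡ (g≤r u)))
      ...   | w , u~w , gw≡2 = ∈N[]⋃-adj G (M₂ s - v)
        (x∈p∧x≢y⇒x∈p-y (g≡2⇒M₂ gw≡2) λ { refl → gv≢2 gw≡2 }) u~w

      2-kept : ∀ {v} → result v ≡ 2F → ¬ (g v ≢ 2F)
      2-kept rv≡2 gv≢2 =
        private-neighbour (result≡2⇒M₂ rv≡2) (lowered⇒covered (result≡2⇒M₂ rv≡2) gv≢2)

      r≤g : result ≤ₗ g
      r≤g v with result v in rv≡ | g v in gv≡
      ... | 0F | _  = z≤n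
      ... | 1F | 0F = contradiction gv≡ (1-kept rv≡)
      ... | 1F | 1F = s≤s z≤n
      ... | 1F | 2F = s≤s z≤n
      ... | 2F | 2F = ≤2 2F
      ... | 2F | 0F = contradiction (λ e → contradiction (trans (sym gv≡) e) λ ()) (2-kept rv≡)
      ... | 2F | 1F = contradiction (λ e → contradiction (trans (sym gv≡) e) λ ()) (2-kept rv≡)

  finish-correct : (answer (finish G s) ≡ YES ⇔ ExtensionRomanDomination G f) ×
                   (answer (finish G s) ≡ YES → IsMinimalRdf G (computed (finish G s)))
  finish-correct with any? (λ v → v ∈? M₂ s ×-dec N G v ⊆? N[ G ]⋃ (M₂ s - v))
  ... | yes (v , v∈M₂ , covered) = mk⇔ (λ ()) no-extension , λ ()
    where
    no-extension : ExtensionRomanDomination G f → NO ≡ YES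
    -- The vertex failing the test lacks a private neighbour with respect to `M₂`, all of which `h`
    -- labels 2.
    no-extension (h , minimal , f≤h) = ⊥-elim (minimal⇒private-neighbour G minimal
      (λ {w} w∈M₂ → 2≤⇒≡2 (subst (_≤ h w) (M₂⇒2 inv w∈M₂) (below inv minimal f≤h w))) v∈M₂ covered)
  ... | no ¬covered = mk⇔ (λ _ → result , minimal , result-extends) (λ _ → refl) , λ _ → minimal
    where
    minimal : IsMinimalRdf G result
    minimal = result-minimal λ v∈M₂ covered → ¬covered (_ , v∈M₂ , covered)

theorem4 : ∀ {n : ℕ} (G : Graph n) (f : Labelling n) (choose : Strategy n) →
    let out = extRDSolver choose G f in
    (answer out ≡ YES ⇔ ExtensionRomanDomination G f) ×
    (answer out ≡ YES → IsMinimalRdf G (computed out))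
theorem4 G f choose with while-induction G choose (Invariant G f) (process-invariant G f)
                           (initial f) (<-wellFounded _) (initial-invariant G f)
... | inv , M≡∅ = finish-correct G f _ inv M≡∅
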